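{- Let $H$ be a graph such that $L(H)$ has a $K_t$-immersion. Then for every integer $m\geq 2$, the line graph $L(mH)$ has a $K_{mt}$-immersion.
   Context: Graphs are finite and may have parallel edges but no loops. The line graph $L(H)$ of a graph $H$ is the simple graph whose vertex set is $E(H)$, in which two distinct edges of $H$ are adjacent iff they share at least one endpoint (so parallel edges of $H$ are adjacent in $L(H)$). For $m\geq 2$, $mH$ denotes the graph obtained from $H$ by replacing each edge $e$ by $m$ parallel copies of $e$. A graph $G$ has a $K_t$-immersion if there is an injective map $\phi$ from the vertex set of $K_t$ to $V(G)$ and, for each pair $u\neq v$ of vertices of $K_t$, a path in $G$ joining $\phi(u)$ and $\phi(v)$, such that these $\binom{t}{2}$ paths are pairwise edge-disjoint (equivalently, $K_t$ can be obtained from a subgraph of $G$ by repeatedly splitting off pairs of adjacent edges and deleting isolated vertices). -}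

module Defs where

open import Data.Nat using (ℕ; _*_)
open import Data.Fin using (Fin; zero; suc; quotient; _<_)
open import Data.Fin.Properties using (_≟_; _<?_; any?; <⇒≢; <-cmp; <-asym)
open import Data.List using (List; []; _∷_; length; lookup; filter; allFin; cartesianProduct)
open import Data.List.Membership.Propositional using (_∈_)
open import Data.List.Membership.Propositional.Properties using (∈-lookup; ∈-filter⁺; ∈-filter⁻; ∈-cartesianProduct⁺; ∈-allFin)
open import Data.List.Relation.Binary.Disjoint.Propositional using (Disjoint)
import Data.List.Relation.Unary.All as All
open import Data.List.Relation.Unary.AllPairs using (_∷_)
open import Data.List.Relation.Unary.Any using (index)
open import Data.List.Relation.Unary.Any.Properties using (lookup-index)
open import Data.List.Relation.Unary.Unique.Propositional using (Unique)
open import Data.List.Relation.Unary.Unique.Propositional.Properties using (filter⁺; cartesianProduct⁺; allFin⁺)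
open import Data.Product using (Σ; ∃; _×_; _,_; proj₁; proj₂)
open import Data.Sum using (_⊎_; inj₁; inj₂)
open import Function.Bundles using (_⇔_; mk⇔)
open import Function.Definitions using (Injective)
open import Relation.Binary.Definitions using (tri<; tri≈; tri>)
open import Relation.Binary.PropositionalEquality using (_≡_; _≢_; refl; sym; trans; subst; cong)
open import Relation.Nullary using (Dec; contradiction)
open import Relation.Nullary.Decidable using (_×-dec_; _⊎-dec_)

-- Finite loopless multigraphs.  The order of the two components of `ends e`
-- carries no meaning: everything below is invariant under swapping them.
record Graph : Set where
  field
    order    : ℕ
    size     : ℕ
    ends     : Fin size → Fin order × Fin order
    loopless : ∀ e → proj₁ (ends e) ≢ proj₂ (ends e)

  Vertex : Set
  Vertex = Fin order

  Edge : Set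
  Edge = Fin size

open Graph public using (Vertex; Edge)

module _ (G : Graph) where
  open Graph G using (ends)

  Incident : Vertex G → Edge G → Set
  Incident x e = x ≡ proj₁ (ends e) ⊎ x ≡ proj₂ (ends e)

  Joins : Edge G → Vertex G → Vertex G → Set
  Joins e x y = ends e ≡ (x , y) ⊎ ends e ≡ (y , x)

  ShareEndpoint : Edge G → Edge G → Set
  ShareEndpoint e f = ∃ λ x → Incident x e × Incident x f

  incident? : ∀ x e → Dec (Incident x e)
  incident? x e = (x ≟ proj₁ (ends e)) ⊎-dec (x ≟ proj₂ (ends e))

  shareEndpoint? : ∀ e f → Dec (ShareEndpoint e f)
  shareEndpoint? e f = any? (λ x → incident? x e ×-dec incident? x f)

  data Walk : Vertex G → Vertex G → Set where
    stop : ∀ {x} → Walk x x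
    step : ∀ {x y z} (e : Edge G) → Joins e x y → Walk y z → Walk x z

  vertices : ∀ {x y} → Walk x y → List (Vertex G)
  vertices {x} stop         = x ∷ []
  vertices {x} (step _ _ w) = x ∷ vertices w

  edges : ∀ {x y} → Walk x y → List (Edge G)
  edges stop         = []
  edges (step e _ w) = e ∷ edges w

  Path : Vertex G → Vertex G → Set
  Path x y = Σ (Walk x y) λ w → Unique (vertices w)

  pathEdges : ∀ {x y} → Path x y → List (Edge G)
  pathEdges (w , _) = edges w

-- A K_t-immersion in G.  V(K_t) = Fin t, and each unordered pair of distinct
-- vertices of K_t is represented once, by (u , v) with u < v.
record CliqueImmersion (t : ℕ) (G : Graph) : Set where
  field
    φ             : Fin t → Vertex G
    φ-injective   : Injective _≡_ _≡_ φ
    path          : ∀ u v → u < v → Path G (φ u) (φ v)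
    edge-disjoint : ∀ u v (u<v : u < v) u′ v′ (u′<v′ : u′ < v′) →
                    (u , v) ≢ (u′ , v′) →
                    Disjoint (pathEdges G (path u v u<v))
                             (pathEdges G (path u′ v′ u′<v′))

-- m · H has the edge set E(H) × {0,…,m-1}, coded as Fin (size * m);
-- `quotient m` recovers the edge of H of which an edge is a copy.
infixr 7 _·_
_·_ : ℕ → Graph → Graph
m · H = record
  { order    = order
  ; size     = size * m
  ; ends     = λ e → ends (quotient m e)
  ; loopless = λ e → loopless (quotient m e)
  }
  where open Graph H

module _ (H : Graph) where

  LineAdjacent : Edge H × Edge H → Set
  LineAdjacent (e , f) = e < f × ShareEndpoint H e f

  lineAdjacent? : ∀ p → Dec (LineAdjacent p)
  lineAdjacent? (e , f) = (e <? f) ×-dec shareEndpoint? H e f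

  private
    pairs : List (Edge H × Edge H)
    pairs = cartesianProduct (allFin _) (allFin _)

  -- Each adjacent pair of distinct edges of H is listed exactly once,
  -- smaller edge first; see L-adjacent and L-simple below.
  linePairs : List (Edge H × Edge H)
  linePairs = filter lineAdjacent? pairs

  linePairs-adjacent : ∀ i → LineAdjacent (lookup linePairs i)
  linePairs-adjacent i =
    proj₂ (∈-filter⁻ lineAdjacent? {xs = pairs} (∈-lookup {xs = linePairs} i))

  L : Graph
  L = record
    { order    = Graph.size H
    ; size     = length linePairs
    ; ends     = lookup linePairs
    ; loopless = λ i → <⇒≢ (proj₁ (linePairs-adjacent i))
    }

  private
    listed : ∀ {e f} → e < f → ShareEndpoint H e f →
             ∃ λ i → lookup linePairs i ≡ (e , f)
    listed {e} {f} e<f s = index mem , sym (lookup-index mem)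
      where
      mem : (e , f) ∈ linePairs
      mem = ∈-filter⁺ lineAdjacent?
              (∈-cartesianProduct⁺ (∈-allFin e) (∈-allFin f)) (e<f , s)

    linePairs-unique : Unique linePairs
    linePairs-unique =
      filter⁺ lineAdjacent? (cartesianProduct⁺ (allFin⁺ _) (allFin⁺ _))

    lookup-injective : ∀ {A : Set} {xs : List A} → Unique xs →
                       ∀ i j → lookup xs i ≡ lookup xs j → i ≡ j
    lookup-injective (_ ∷ _)  zero    zero    _  = refl
    lookup-injective (x ∷ _)  zero    (suc j) eq = contradiction eq (All.lookup x (∈-lookup j))
    lookup-injective (x ∷ _)  (suc i) zero    eq = contradiction (sym eq) (All.lookup x (∈-lookup i))
    lookup-injective (_ ∷ xs) (suc i) (suc j) eq = cong suc (lookup-injective xs i j eq)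

    ascending : ∀ i {e f} → lookup linePairs i ≡ (e , f) → LineAdjacent (e , f)
    ascending i eq = subst LineAdjacent eq (linePairs-adjacent i)

    share-sym : ∀ {e f} → ShareEndpoint H e f → ShareEndpoint H f e
    share-sym (x , p , q) = x , q , p

  L-adjacent : ∀ {e f} → (∃ λ i → Joins L i e f) ⇔ (e ≢ f × ShareEndpoint H e f)
  L-adjacent {e} {f} = mk⇔ to from
    where
    to : (∃ λ i → Joins L i e f) → e ≢ f × ShareEndpoint H e f
    to (i , inj₁ eq) with e<f , s ← ascending i eq = <⇒≢ e<f , s
    to (i , inj₂ eq) with f<e , s ← ascending i eq =
      (λ e≡f → <⇒≢ f<e (sym e≡f)) , share-sym s

    from : e ≢ f × ShareEndpoint H e f → ∃ λ i → Joins L i e f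
    from (e≢f , s) with <-cmp e f
    ... | tri< e<f _ _ = let i , eq = listed e<f s in i , inj₁ eq
    ... | tri≈ _ e≡f _ = contradiction e≡f e≢f
    ... | tri> _ _ f<e = let i , eq = listed f<e (share-sym s) in i , inj₂ eq

  L-simple : ∀ {i j e f} → Joins L i e f → Joins L j e f → i ≡ j
  L-simple {i} {j} = go
    where
    same : ∀ {p} → lookup linePairs i ≡ p → lookup linePairs j ≡ p → i ≡ j
    same p q = lookup-injective linePairs-unique _ _ (trans p (sym q))

    go : ∀ {e f} → Joins L i e f → Joins L j e f → i ≡ j
    go (inj₁ p) (inj₁ q) = same p q
    go (inj₂ p) (inj₂ q) = same p q
    go (inj₁ p) (inj₂ q) =
      contradiction (proj₁ (ascending j q)) (<-asym (proj₁ (ascending i p)))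
    go (inj₂ p) (inj₁ q) =
      contradiction (proj₁ (ascending j q)) (<-asym (proj₁ (ascending i p)))

{-# OPTIONS --safe #-}

-- L(mH) is L(H) with every vertex e blown up to a clique {e} × [m] and every
-- edge to a K_{m,m}.  The branch vertices are all copies of those of the given
-- K_t-immersion.  Two copies of one branch vertex are adjacent.  For a path
-- x₀,…,xₙ of the immersion, the m² pairs of copies (x₀,i), (xₙ,j) are joined
-- inside the blow-up of that path by attaching to its vertices the labels
--   i, j, i, j, …, j                    if n is odd,
--   i, i+j, j, i+j, j, …, j  (mod m)    if n is even.
-- Any two consecutive labels determine (i,j), so these m² paths use each
-- K_{m,m} edge at most once.

module Submission where

open import Data.Nat using (ℕ; suc; _*_; _+_; _∸_; _%_; _≤_; NonZero)
open import Data.Nat.DivMod using (_mod_; m%n<n; %-distribˡ-+; [m+n]%n≡m%n; m<n⇒m%n≡m)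
open import Data.Nat.Properties using (+-assoc; +-comm; *-comm; m∸n+n≡m; <⇒≤)
open import Data.Fin using (Fin; toℕ; combine; quotient; remainder; _<_)
open import Data.Fin.Properties using (_≟_; <⇒≢; <-cmp; <-asym; <-irrelevant; toℕ<n; toℕ-injective; toℕ-fromℕ<; remQuot-combine; combine-remQuot; combine-injective; combine-monoˡ-<)
open import Data.Empty using (⊥)
open import Data.List using (map; []; _∷_)
open import Data.List.Membership.Propositional using (_∈_)
open import Data.List.Relation.Binary.Disjoint.Propositional using (Disjoint)
open import Data.List.Relation.Unary.All using ([]; _∷_)
import Data.List.Relation.Unary.All as All
open import Data.List.Relation.Unary.AllPairs using ([]; _∷_)
open import Data.List.Relation.Unary.Any using (here; there)
open import Data.List.Relation.Unary.Unique.Propositional using (Unique)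
open import Data.List.Relation.Unary.Unique.Propositional.Properties using (map⁻)
open import Data.Product using (∃; _×_; _,_; proj₁; proj₂)
import Data.Product as Product
open import Data.Product.Properties using (,-injective; ≡-dec)
open import Data.Sum using (_⊎_; inj₁; inj₂)
import Data.Sum as Sum
open import Data.Unit using (⊤)
open import Function.Base using (_∘_)
open import Function.Bundles using (Equivalence)
open import Relation.Binary.Definitions using (tri<; tri≈; tri>)
open import Relation.Binary.PropositionalEquality
open import Relation.Nullary using (¬_; yes; no; contradiction)
open import Relation.Nullary.Decidable using (_×-dec_)
open import Defs

-- Cancellation for addition modulo `m`.

module ModularAddition (m : ℕ) .{{_ : NonZero m}} where

  infixl 6 _⊕_
  _⊕_ : Fin m → Fin m → Fin m
  i ⊕ j = (toℕ i + toℕ j) mod m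

  ⊕-comm : ∀ i j → i ⊕ j ≡ j ⊕ i
  ⊕-comm i j = cong (_mod m) (+-comm (toℕ i) (toℕ j))

  private
    -- Adding the complement `m ∸ toℕ j` brings the sum to `toℕ i + m`, which reduces to `toℕ i`;
    -- hence `i` can be read off from `i ⊕ j` and `j`.
    ⊕-subtract : ∀ i j → (toℕ (i ⊕ j) + (m ∸ toℕ j)) % m ≡ toℕ i
    ⊕-subtract i j = begin
      (toℕ (i ⊕ j) + c) % m               ≡⟨ cong (λ n → (n + c) % m) (toℕ-fromℕ< (m%n<n (a + b) m)) ⟩
      ((a + b) % m + c) % m               ≡⟨ %-distribˡ-+ ((a + b) % m) c m ⟩
      ((a + b) % m % m + c % m) % m       ≡⟨ cong (λ n → (n + c % m) % m) (m<n⇒m%n≡m (m%n<n (a + b) m)) ⟩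
      ((a + b) % m + c % m) % m           ≡⟨ %-distribˡ-+ (a + b) c m ⟨
      (a + b + c) % m                     ≡⟨ cong (_% m) (+-assoc a b c) ⟩
      (a + (b + c)) % m                   ≡⟨ cong (λ n → (a + n) % m) (trans (+-comm b c) (m∸n+n≡m (<⇒≤ (toℕ<n j)))) ⟩
      (a + m) % m                         ≡⟨ [m+n]%n≡m%n a m ⟩
      a % m                               ≡⟨ m<n⇒m%n≡m (toℕ<n i) ⟩
      a                                   ∎
      where
      open ≡-Reasoning
      a b c : ℕ
      a = toℕ i
      b = toℕ j
      c = m ∸ toℕ j

  ⊕-cancelʳ : ∀ j {i i′} → i ⊕ j ≡ i′ ⊕ j → i ≡ i′
  ⊕-cancelʳ j {i} {i′} eq = toℕ-injective (begin
    toℕ i                              ≡⟨ ⊕-subtract i j ⟨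
    (toℕ (i ⊕ j) + (m ∸ toℕ j)) % m    ≡⟨ cong (λ k → (toℕ k + (m ∸ toℕ j)) % m) eq ⟩
    (toℕ (i′ ⊕ j) + (m ∸ toℕ j)) % m   ≡⟨ ⊕-subtract i′ j ⟩
    toℕ i′                             ∎)
    where open ≡-Reasoning

  ⊕-cancelˡ : ∀ i {j j′} → i ⊕ j ≡ i ⊕ j′ → j ≡ j′
  ⊕-cancelˡ i {j} {j′} eq =
    ⊕-cancelʳ i (trans (⊕-comm j i) (trans eq (⊕-comm i j′)))

-- Edges, walks and their parity in a multigraph.

module _ {G : Graph} where
  open Graph G using (loopless)

  joins-sym : ∀ {e x y} → Joins G e x y → Joins G e y x
  joins-sym = Sum.swap

  joins⇒≢ : ∀ {e x y} → Joins G e x y → x ≢ y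
  joins⇒≢ {e} (inj₁ eq) x≡y =
    loopless e (trans (cong proj₁ eq) (trans x≡y (sym (cong proj₂ eq))))
  joins⇒≢ {e} (inj₂ eq) x≡y =
    loopless e (trans (cong proj₁ eq) (trans (sym x≡y) (sym (cong proj₂ eq))))

  joins-unique : ∀ {e x y x′ y′} → Joins G e x y → Joins G e x′ y′ →
                 (x ≡ x′ × y ≡ y′) ⊎ (x ≡ y′ × y ≡ x′)
  joins-unique (inj₁ p) (inj₁ q) = inj₁ (,-injective (trans (sym p) q))
  joins-unique (inj₁ p) (inj₂ q) = inj₂ (,-injective (trans (sym p) q))
  joins-unique (inj₂ p) (inj₁ q) = inj₂ (Product.swap (,-injective (trans (sym p) q)))
  joins-unique (inj₂ p) (inj₂ q) = inj₁ (Product.swap (,-injective (trans (sym p) q)))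

  start∈vertices : ∀ {x y} (w : Walk G x y) → x ∈ vertices G w
  start∈vertices stop         = here refl
  start∈vertices (step _ _ _) = here refl

  -- `Joins` is symmetric, so this reaches both ends of `e`. It turns a repeated edge into a
  -- repeated vertex, which a path forbids.
  end∈vertices : ∀ {e x y a b} (w : Walk G a b) →
                 e ∈ edges G w → Joins G e x y → x ∈ vertices G w
  end∈vertices (step e p w) (here refl) q with joins-unique q p
  ... | inj₁ (x≡a , _) = here x≡a
  ... | inj₂ (refl , _) = there (start∈vertices w)
  end∈vertices (step _ _ w) (there e∈w) q = there (end∈vertices w e∈w q)

  mutual
    data Even : ∀ {x y} → Walk G x y → Set where
      stop : ∀ {x} → Even (stop {x = x})
      step : ∀ {x y z e} {p : Joins G e x y} {w : Walk G y z} → Odd w → Even (step e p w)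

    data Odd : ∀ {x y} → Walk G x y → Set where
      step : ∀ {x y z e} {p : Joins G e x y} {w : Walk G y z} → Even w → Odd (step e p w)

  parity : ∀ {x y} (w : Walk G x y) → Even w ⊎ Odd w
  parity stop         = inj₁ stop
  parity (step _ _ w) = Sum.swap (Sum.map step step (parity w))

-- Label sequences along a walk.

-- Labelling w i l: labels for the vertices of w, from i at its start to l at its end.
module Labels (G : Graph) (m : ℕ) .{{_ : NonZero m}} where
  open ModularAddition m

  data Labelling : ∀ {x y} → Walk G x y → Fin m → Fin m → Set where
    stop : ∀ {x i} → Labelling (stop {x = x}) i i
    step : ∀ {x y z e i l} {p : Joins G e x y} {w : Walk G y z} (j : Fin m) →
           Labelling w j l → Labelling (step e p w) i l

  -- Compares equal positions only, in the direction of travel: different positions on a path lie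
  -- over different edges, so two lifts of it cannot meet there.
  Apart : ∀ {x y} {w : Walk G x y} {i l i′ l′} →
          Labelling w i l → Labelling w i′ l′ → Set
  Apart stop stop = ⊤
  Apart {i = i} {i′ = i′} (step j c) (step j′ c′) =
    ¬ (i ≡ i′ × j ≡ j′) × Apart c c′

  mutual
    alternateOdd : ∀ {x y} {w : Walk G x y} → Odd w → ∀ i j → Labelling w i j
    alternateOdd (step p) i j = step j (alternateEven p j i)

    alternateEven : ∀ {x y} {w : Walk G x y} → Even w → ∀ i j → Labelling w i i
    alternateEven stop     i j = stop
    alternateEven (step p) i j = step j (alternateOdd p j i)

  mutual
    -- Consecutive labels are `i , j` and `j , i` in turn, so the one hypothesis, with its
    -- components swapped, serves every step.
    alternateOdd-apart : ∀ {x y} {w : Walk G x y} (p : Odd w) {i j i′ j′} →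
      ¬ (i ≡ i′ × j ≡ j′) → Apart (alternateOdd p i j) (alternateOdd p i′ j′)
    alternateOdd-apart (step p) ne = ne , alternateEven-apart p (ne ∘ Product.swap)

    alternateEven-apart : ∀ {x y} {w : Walk G x y} (p : Even w) {i j i′ j′} →
      ¬ (i ≡ i′ × j ≡ j′) → Apart (alternateEven p i j) (alternateEven p i′ j′)
    alternateEven-apart stop     ne = _
    alternateEven-apart (step p) ne = ne , alternateOdd-apart p (ne ∘ Product.swap)

  -- The ends differ, so the walk is nonempty; an empty walk would force `i ≡ j`.
  labelling : ∀ {x y} → x ≢ y → (w : Walk G x y) → ∀ i j → Labelling w i j
  labelling x≢y w i j with parity w
  ... | inj₁ stop     = contradiction refl x≢y
  ... | inj₁ (step p) = step (i ⊕ j) (alternateOdd p (i ⊕ j) j)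
  ... | inj₂ p        = alternateOdd p i j

  labelling-apart : ∀ {x y} (x≢y : x ≢ y) (w : Walk G x y) {i j i′ j′} →
    ¬ (i ≡ i′ × j ≡ j′) → Apart (labelling x≢y w i j) (labelling x≢y w i′ j′)
  labelling-apart x≢y w ne with parity w
  ... | inj₁ stop     = contradiction refl x≢y
  ... | inj₁ (step p) =
    -- The first edge carries `i , i ⊕ j`, and cancelling `i` on the left recovers `j`. Later edges
    -- carry `i ⊕ j` and `j` alternately, and cancelling `j` on the right recovers `i`.
    (λ { (refl , eq) → ne (refl , ⊕-cancelˡ _ eq) }) ,
    alternateOdd-apart p (λ { (eq , refl) → ne (⊕-cancelʳ _ eq , refl) })
  ... | inj₂ p        = alternateOdd-apart p ne

-- The blow-up of `L H` inside `L (m · H)`.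

module BlowUp (H : Graph) (m : ℕ) .{{_ : NonZero m}} where
  open Labels (L H) m

  LH LmH : Graph
  LH  = L H
  LmH = L (m · H)

  copy : Vertex LH → Fin m → Vertex LmH
  copy = combine

  base : Vertex LmH → Vertex LH
  base = quotient {Graph.size H} m

  base-copy : ∀ e i → base (copy e i) ≡ e
  base-copy e i = cong proj₁ (remQuot-combine {Graph.size H} {m} e i)

  share-copy : ∀ {e f} → ShareEndpoint H e f → ∀ i j →
               ShareEndpoint (m · H) (copy e i) (copy f j)
  share-copy {e} {f} s i j =
    subst₂ (ShareEndpoint H) (sym (base-copy e i)) (sym (base-copy f j)) s

  copies-adjacent : ∀ {e f} → ShareEndpoint H e f → ∀ i j → copy e i ≢ copy f j →
                    ∃ λ k → Joins LmH k (copy e i) (copy f j)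
  copies-adjacent s i j ne =
    Equivalence.from (L-adjacent (m · H)) (ne , share-copy s i j)

  lift-edge : ∀ {k e f} → Joins LH k e f → ∀ i j →
              ∃ λ k′ → Joins LmH k′ (copy e i) (copy f j)
  lift-edge {k} {e} {f} p i j with e≢f , s ← Equivalence.to (L-adjacent H) (k , p) =
    copies-adjacent s i j (e≢f ∘ proj₁ ∘ combine-injective e i f j)

  sibling-edge : ∀ e {i j} → i ≢ j → ∃ λ k → Joins LmH k (copy e i) (copy e j)
  sibling-edge e {i} {j} i≢j =
    copies-adjacent (proj₁ (Graph.ends H e) , inj₁ refl , inj₁ refl) i j
      (i≢j ∘ proj₂ ∘ combine-injective e i e j)

  -- Phrased through the ends of `k′` alone, so that it does not depend on how `k′` was obtained; as
  -- `L H` is simple, `k′` lies over at most one edge.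
  Over : Edge LmH → Edge LH → Set
  Over k′ k = Joins LH k (base (proj₁ (Graph.ends LmH k′))) (base (proj₂ (Graph.ends LmH k′)))

  over-unique : ∀ {k′ k₁ k₂} → Over k′ k₁ → Over k′ k₂ → k₁ ≡ k₂
  over-unique = L-simple H

  over⁺ : ∀ {k k′ e f i j} → Joins LH k e f → Joins LmH k′ (copy e i) (copy f j) → Over k′ k
  over⁺ {k} {e = e} {f} {i} {j} p (inj₁ eq) =
    subst (λ (a , b) → Joins LH k (base a) (base b)) (sym eq)
      (subst₂ (Joins LH k) (sym (base-copy e i)) (sym (base-copy f j)) p)
  over⁺ {k} {e = e} {f} {i} {j} p (inj₂ eq) =
    subst (λ (a , b) → Joins LH k (base a) (base b)) (sym eq)
      (subst₂ (Joins LH k) (sym (base-copy f j)) (sym (base-copy e i)) (joins-sym {LH} p))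

  sibling-not-over : ∀ {k k′ e i j} → Joins LmH k′ (copy e i) (copy e j) → ¬ Over k′ k
  sibling-not-over {e = e} {i} {j} (inj₁ eq) o = joins⇒≢ {LH} o
    (trans (cong (base ∘ proj₁) eq) (trans (base-copy e i)
      (sym (trans (cong (base ∘ proj₂) eq) (base-copy e j)))))
  sibling-not-over {e = e} {i} {j} (inj₂ eq) o = joins⇒≢ {LH} o
    (trans (cong (base ∘ proj₁) eq) (trans (base-copy e j)
      (sym (trans (cong (base ∘ proj₂) eq) (base-copy e i)))))

  lift : ∀ {x y} {w : Walk LH x y} {i l} → Labelling w i l → Walk LmH (copy x i) (copy y l)
  lift stop = stop
  lift {i = i} (step {p = p} j c) with k , q ← lift-edge p i j = step k q (lift c)

  -- This makes the lift of a path a path: vertices with distinct projections are distinct.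
  base-vertices : ∀ {x y} {w : Walk LH x y} {i l} (c : Labelling w i l) →
                  map base (vertices LmH (lift c)) ≡ vertices LH w
  base-vertices {x} {i = i} stop       = cong (_∷ []) (base-copy x i)
  base-vertices {x} {i = i} (step j c) = cong₂ _∷_ (base-copy x i) (base-vertices c)

  liftPath : ∀ {x y} (P : Path LH x y) {i l} → Labelling (proj₁ P) i l →
             Path LmH (copy x i) (copy y l)
  liftPath (_ , uniq) c = lift c , map⁻ (subst Unique (sym (base-vertices c)) uniq)

  lift-over : ∀ {x y} {w : Walk LH x y} {i l} (c : Labelling w i l) {k′} →
              k′ ∈ edges LmH (lift c) → ∃ λ k → k ∈ edges LH w × Over k′ k
  lift-over {i = i} (step {e = e} {p = p} j c) (here refl) =
    e , here refl , over⁺ p (proj₂ (lift-edge p i j))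
  lift-over (step j c) (there k′∈c) with k , k∈w , o ← lift-over c k′∈c =
    k , there k∈w , o

  -- If `k′` occurred in the rest, it would lie over an edge of `w`, which by simplicity of `L H` is
  -- `e`; then `x` would recur on `w`. The labelling `c` is arbitrary, so the rest may belong to
  -- another lift of the same path.
  lift-first∉rest : ∀ {e x y z i j k′} (p : Joins LH e x y) {w : Walk LH y z} →
                    Unique (vertices LH (step e p w)) →
                    Joins LmH k′ (copy x i) (copy y j) →
                    ∀ {j′ l} (c : Labelling w j′ l) → ¬ k′ ∈ edges LmH (lift c)
  lift-first∉rest p {w} (x∉w ∷ _) q c k′∈c
    with k , k∈w , o ← lift-over c k′∈c
    with refl ← over-unique (over⁺ p q) o =
    All.lookup x∉w (end∈vertices {LH} w k∈w p) refl

  lift-disjoint : ∀ {x y} {w : Walk LH x y} → Unique (vertices LH w) →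
                  ∀ {i l i′ l′} (c : Labelling w i l) (c′ : Labelling w i′ l′) →
                  Apart c c′ → Disjoint (edges LmH (lift c)) (edges LmH (lift c′))
  lift-disjoint uniq stop stop _ (() , _)
  lift-disjoint uniq {i} {i′ = i′} (step {x = x} {y} {p = p} j c) (step j′ c′) (ne , _) (here refl , here eq)
    with joins-unique {LmH} (proj₂ (lift-edge p i j))
           (subst (λ k → Joins LmH k _ _) (sym eq) (proj₂ (lift-edge p i′ j′)))
  ... | inj₁ (eqx , eqy) = ne (proj₂ (combine-injective x i x i′ eqx) , proj₂ (combine-injective y j y j′ eqy))
  -- Opposite traversal would identify copies of the two ends of one edge of `L H`.
  ... | inj₂ (eqx , _)   = joins⇒≢ {LH} p (proj₁ (combine-injective x i y j′ eqx))
  lift-disjoint uniq {i} (step {p = p} j c) (step j′ c′) _ (here refl , there k∈c′) =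
    lift-first∉rest p uniq (proj₂ (lift-edge p i j)) c′ k∈c′
  lift-disjoint uniq {i′ = i′} (step {p = p} j c) (step j′ c′) _ (there k∈c , here refl) =
    lift-first∉rest p uniq (proj₂ (lift-edge p i′ j′)) c k∈c
  lift-disjoint (_ ∷ uniq) (step j c) (step j′ c′) (_ , ap) (there k∈c , there k∈c′) =
    lift-disjoint uniq c c′ ap (k∈c , k∈c′)

-- Assembling the clique immersion.

module Immersion (H : Graph) (t : ℕ) (I : CliqueImmersion t (L H)) (m : ℕ) .{{_ : NonZero m}} where
  open CliqueImmersion I
  open Labels (L H) m
  open BlowUp H m

  -- Strict lexicographic comparison of (u,i) and (v,j), weakened to what the
  -- construction needs; on t * m it is implied by the order of the indices.
  Precedes : Fin t × Fin m → Fin t × Fin m → Set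
  Precedes (u , i) (v , j) = u < v ⊎ (u ≡ v × i ≢ j)

  branch : Fin t × Fin m → Vertex LmH
  branch (u , i) = copy (φ u) i

  branch-injective : ∀ {a b} → branch a ≡ branch b → a ≡ b
  branch-injective {u , i} {v , j} eq
    with p , refl ← combine-injective (φ u) i (φ v) j eq
    with refl ← φ-injective p = refl

  branches-differ : ∀ {u v} → u < v → φ u ≢ φ v
  branches-differ u<v = <⇒≢ u<v ∘ φ-injective

  route : ∀ {u v} (u<v : u < v) i j → Labelling (proj₁ (path u v u<v)) i j
  route {u} {v} u<v = labelling (branches-differ u<v) (proj₁ (path u v u<v))

  connect : ∀ {a b} → Precedes a b → Path LmH (branch a) (branch b)
  connect {u , i} {v , j} (inj₁ u<v) = liftPath (path u v u<v) (route u<v i j)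
  connect {u , i} {_ , j} (inj₂ (refl , i≢j)) with k , p ← sibling-edge (φ u) i≢j =
    step k p stop , (joins⇒≢ {LmH} p ∷ []) ∷ [] ∷ []

  -- Unordered, because an edge between siblings determines its two branch vertices only up to
  -- order.
  SamePair : (a b a′ b′ : Fin t × Fin m) → Set
  SamePair a b a′ b′ = (a ≡ a′ × b ≡ b′) ⊎ (a ≡ b′ × b ≡ a′)

  sibling-off-lift : ∀ {u v i j w k l} (u<v : u < v) (k≢l : k ≢ l) {e} →
                     e ∈ pathEdges LmH (connect {u , i} {v , j} (inj₁ u<v)) →
                     e ∈ pathEdges LmH (connect {w , k} {w , l} (inj₂ (refl , k≢l))) → ⊥
  sibling-off-lift {w = w} u<v k≢l e∈ (here refl) with _ , _ , o ← lift-over (route u<v _ _) e∈ =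
    sibling-not-over (proj₂ (sibling-edge (φ w) k≢l)) o

  -- A common edge lies over a single edge of `L H`, which would then be on two different paths of
  -- the given immersion.
  lifts-disjoint : ∀ {u v u′ v′} (u<v : u < v) (u′<v′ : u′ < v′) {i j i′ j′} →
                   (u , v) ≢ (u′ , v′) →
                   Disjoint (edges LmH (lift (route u<v i j))) (edges LmH (lift (route u′<v′ i′ j′)))
  lifts-disjoint u<v u′<v′ ne (e∈ , e∈′)
    with k , k∈ , o ← lift-over (route u<v _ _) e∈
       | k′ , k′∈ , o′ ← lift-over (route u′<v′ _ _) e∈′
    with refl ← over-unique o o′ =
    edge-disjoint _ _ u<v _ _ u′<v′ ne (k∈ , k′∈)

  routes-disjoint : ∀ {u v} (u<v : u < v) {i j i′ j′} → ¬ (i ≡ i′ × j ≡ j′) →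
                    Disjoint (edges LmH (lift (route u<v i j))) (edges LmH (lift (route u<v i′ j′)))
  routes-disjoint {u} {v} u<v ne =
    lift-disjoint (proj₂ (path u v u<v)) (route u<v _ _) (route u<v _ _)
      (labelling-apart (branches-differ u<v) (proj₁ (path u v u<v)) ne)

  connect-shared : ∀ {a b a′ b′} (p : Precedes a b) (p′ : Precedes a′ b′) {e} →
                   e ∈ pathEdges LmH (connect p) → e ∈ pathEdges LmH (connect p′) →
                   SamePair a b a′ b′
  connect-shared {u , i} {v , j} {u′ , i′} {v′ , j′} (inj₁ u<v) (inj₁ u′<v′) e∈ e∈′
    with ≡-dec _≟_ _≟_ (u , v) (u′ , v′)
  ... | no ne = contradiction (e∈ , e∈′) (lifts-disjoint u<v u′<v′ ne)
  ... | yes refl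
    -- `path` takes the proof of `u < v` as an argument, so the two proofs must be identified before
    -- both routes label the same walk.
    with refl ← <-irrelevant u<v u′<v′
    with (i ≟ i′) ×-dec (j ≟ j′)
  ... | yes (refl , refl) = inj₁ (refl , refl)
  ... | no ne             = contradiction (e∈ , e∈′) (routes-disjoint u<v ne)
  connect-shared (inj₁ u<v) (inj₂ (refl , i≢j)) e∈ e∈′ =
    contradiction e∈′ (sibling-off-lift u<v i≢j e∈)
  connect-shared (inj₂ (refl , i≢j)) (inj₁ u<v) e∈ e∈′ =
    contradiction e∈ (sibling-off-lift u<v i≢j e∈′)
  connect-shared {u , i} {_ , j} {u′ , i′} {_ , j′} (inj₂ (refl , i≢j)) (inj₂ (refl , i′≢j′)) (here refl) (here eq) =
    Sum.map (Product.map branch-injective branch-injective)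
            (Product.map branch-injective branch-injective)
      (joins-unique {LmH} (proj₂ (sibling-edge (φ u) i≢j))
        (subst (λ k → Joins LmH k _ _) (sym eq) (proj₂ (sibling-edge (φ u′) i′≢j′))))

  coordinates : Fin (t * m) → Fin t × Fin m
  coordinates a = quotient {t} m a , remainder {t} m a

  coordinates-injective : ∀ {a b} → coordinates a ≡ coordinates b → a ≡ b
  coordinates-injective {a} {b} eq =
    trans (sym (combine-remQuot {t} m a))
      (trans (cong (λ (u , i) → combine u i) eq) (combine-remQuot {t} m b))

  -- `combine` makes the order on `Fin (t * m)` lexicographic, with the `Fin t` component leading.
  coordinates-precede : ∀ {a b} → a < b → Precedes (coordinates a) (coordinates b)
  coordinates-precede {a} {b} a<b with <-cmp (quotient {t} m a) (quotient {t} m b)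
  ... | tri< u<v _ _ = inj₁ u<v
  ... | tri≈ _ u≡v _ = inj₂ (u≡v , λ i≡j → <⇒≢ a<b (coordinates-injective (cong₂ _,_ u≡v i≡j)))
  ... | tri> _ _ v<u = contradiction
    (subst₂ _<_ (combine-remQuot {t} m b) (combine-remQuot {t} m a)
      (combine-monoˡ-< (remainder {t} m b) (remainder {t} m a) v<u))
    (<-asym a<b)

  blowUp : CliqueImmersion (t * m) LmH
  blowUp = record
    { φ             = branch ∘ coordinates
    ; φ-injective   = coordinates-injective ∘ branch-injective
    ; path          = λ a b a<b → connect (coordinates-precede a<b)
    ; edge-disjoint = disjoint
    }
    where
    disjoint : ∀ a b (a<b : a < b) a′ b′ (a′<b′ : a′ < b′) → (a , b) ≢ (a′ , b′) →
               Disjoint (pathEdges LmH (connect (coordinates-precede a<b)))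
                        (pathEdges LmH (connect (coordinates-precede a′<b′)))
    disjoint a b a<b a′ b′ a′<b′ ne (e∈ , e∈′)
      with connect-shared (coordinates-precede a<b) (coordinates-precede a′<b′) e∈ e∈′
    ... | inj₁ (p , q) = ne (cong₂ _,_ (coordinates-injective p) (coordinates-injective q))
    -- Both pairs are listed in increasing order, so a crossed match would give `b < a`.
    ... | inj₂ (p , q) =
      <-asym a<b (subst₂ _<_ (sym (coordinates-injective q)) (sym (coordinates-injective p)) a′<b′)

theorem1p2 : (H : Graph) (t : ℕ) → CliqueImmersion t (L H) →
    (m : ℕ) → 2 ≤ m → CliqueImmersion (m * t) (L (m · H))
-- `2 ≤ m` excludes `m = 0`, and matching on `suc` supplies the `NonZero` instance. The coordinates
-- put `Fin t` first, so the product has to be commuted.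
theorem1p2 H t I m@(suc _) _ =
  subst (λ n → CliqueImmersion n (L (m · H))) (*-comm t m) (Immersion.blowUp H t I m)
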